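{- The varieties $\mathbb{RDMP}$ (regular De Morgan p-algebras) and $\mathbb{RDMDBLP}$ (regular De Morgan double p-algebras) are term-equivalent to each other.
   Context: A De Morgan algebra is a bounded distributive lattice with a unary operation ${}'$ satisfying $x''\approx x$, $(x\vee y)'\approx x'\wedge y'$, $(x\wedge y)'\approx x'\vee y'$, $0'\approx1$, $1'\approx0$. Write $x'{}^*{}'$ for $((x')^*)'$. $\mathbb{RDMP}$: algebras $\langle A,\vee,\wedge,{}^*,{}',0,1\rangle$ such that $\langle A,\vee,\wedge,{}',0,1\rangle$ is a De Morgan algebra, ${}^*$ is the pseudocomplement ($x^*$ is the largest $z$ with $x\wedge z=0$), and the regularity identity $(x\wedge x'{}^*{}')\vee(y\vee y^*)\approx y\vee y^*$ holds. $\mathbb{RDMDBLP}$: algebras $\langle A,\vee,\wedge,{}^*,{}^+,{}',0,1\rangle$ such that $\langle A,\vee,\wedge,{}',0,1\rangle$ is a De Morgan algebra, ${}^*$ is the pseudocomplement, ${}^+$ is the dual pseudocomplement ($x^+$ is the least $z$ with $x\vee z=1$), and the same regularity identity holds. Two varieties $\mathbb V,\mathbb W$ are term-equivalent if each basic operation symbol of $\mathbb W$ can be assigned a term of the same arity in the language of $\mathbb V$, and conversely, so that replacing the basic operations of $\mathbf A\in\mathbb V$ by the assigned term operations gives (on the same universe) an algebra in $\mathbb W$, and conversely, and these two constructions are mutually inverse. Here $\vee,\wedge,{}',0,1$ are kept unchanged. -}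

module Defs where

open import Algebra.Core using (Op₁; Op₂)
open import Data.Fin.Base using (Fin)
open import Data.Nat.Base using (ℕ)
open import Data.Product.Base using (_×_)
open import Data.Vec.Functional using (Vector; []; _∷_)
open import Level using (Level; _⊔_) renaming (suc to lsuc)
open import Relation.Binary.Bundles using (Setoid)
open import Relation.Binary.Core using (Rel)
open import Relation.Binary.PropositionalEquality.Core using (_≡_)
import Algebra.Definitions
import Algebra.Lattice.Structures

------------------------------------------------------------------------
-- Universal algebra

-- The elements of S n are the n-ary operation symbols.
Signature : Set₁
Signature = ℕ → Set

data Term (S : Signature) (n : ℕ) : Set where
  var : Fin n → Term S n
  app : ∀ {k} → S k → Vector (Term S n) k → Term S n

basic : ∀ {S n} → S n → Term S n
basic f = app f var

-- Equality of elements is a setoid equality, respected by all operations.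
record Algebra (S : Signature) (c ℓ : Level) : Set (lsuc (c ⊔ ℓ)) where
  field
    setoid : Setoid c ℓ

  open Setoid setoid public

  field
    op      : ∀ {n} → S n → Vector Carrier n → Carrier
    op-cong : ∀ {n} (f : S n) {xs ys : Vector Carrier n} →
              (∀ i → xs i ≈ ys i) → op f xs ≈ op f ys

  eval : ∀ {n} → Term S n → Vector Carrier n → Carrier
  eval (var i)    xs = xs i
  eval (app f ts) xs = op f (λ i → eval (ts i) xs)

  eval-cong : ∀ {n} (t : Term S n) {xs ys : Vector Carrier n} →
              (∀ i → xs i ≈ ys i) → eval t xs ≈ eval t ys
  eval-cong (var i)    e = e i
  eval-cong (app f ts) e = op-cong f (λ i → eval-cong (ts i) e)

-- A term in the language of T for each operation symbol of S.
Assignment : Signature → Signature → Set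
Assignment S T = ∀ {n} → S n → Term T n

-- The S-algebra, on the same universe, of the assigned term operations.
derived : ∀ {S T c ℓ} → Assignment S T → Algebra T c ℓ → Algebra S c ℓ
derived τ A = record
  { setoid  = Algebra.setoid A
  ; op      = λ f → Algebra.eval A (τ f)
  ; op-cong = λ f → Algebra.eval-cong A (τ f)
  }

Class : Signature → (c ℓ : Level) → Set (lsuc (c ⊔ ℓ))
Class S c ℓ = Algebra S c ℓ → Set (c ⊔ ℓ)

record TermEquivalence {S T : Signature} {c ℓ : Level}
                       (V : Class S c ℓ) (W : Class T c ℓ)
                       : Set (lsuc (c ⊔ ℓ)) where
  field
    to   : Assignment T S
    from : Assignment S T

    to-class   : ∀ A → V A → W (derived {T} {S} to A)
    from-class : ∀ B → W B → V (derived {S} {T} from B)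

    from-to : ∀ A → V A → let open Algebra A in
              ∀ {n} (f : S n) (xs : Vector Carrier n) →
              Algebra.op (derived {S} {T} from (derived {T} {S} to A)) f xs
                ≈ op f xs
    to-from : ∀ B → W B → let open Algebra B in
              ∀ {n} (g : T n) (xs : Vector Carrier n) →
              Algebra.op (derived {T} {S} to (derived {S} {T} from B)) g xs
                ≈ op g xs

-- The symbols of R, regarded as symbols of both S and T via ι and κ, are
-- assigned themselves in both directions.
KeepsUnchanged : ∀ {R S T : Signature} {c ℓ}
                 {V : Class S c ℓ} {W : Class T c ℓ} →
                 (ι : ∀ {n} → R n → S n) (κ : ∀ {n} → R n → T n) →
                 TermEquivalence V W → Set
KeepsUnchanged {R} ι κ E =
  ∀ {n} (r : R n) → to (κ r) ≡ basic (ι r) × from (ι r) ≡ basic (κ r)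
  where open TermEquivalence E

------------------------------------------------------------------------
-- Regular De Morgan (double) p-algebras

module _ {a ℓ} {A : Set a} (_≈_ : Rel A ℓ) where

  open Algebra.Definitions _≈_
  open Algebra.Lattice.Structures _≈_

  record IsDeMorganAlgebra (_∨_ _∧_ : Op₂ A) (_′ : Op₁ A) (0# 1# : A)
                           : Set (a ⊔ ℓ) where
    field
      isDistributiveLattice : IsDistributiveLattice _∨_ _∧_
      ∨-identity            : Identity 0# _∨_
      ∧-identity            : Identity 1# _∧_
      ′-cong                : Congruent₁ _′
      ′-involutive          : Involutive _′
      ′-∨                   : ∀ x y → ((x ∨ y) ′) ≈ ((x ′) ∧ (y ′))
      ′-∧                   : ∀ x y → ((x ∧ y) ′) ≈ ((x ′) ∨ (y ′))
      ′-0                   : (0# ′) ≈ 1#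
      ′-1                   : (1# ′) ≈ 0#

  -- The lattice order x ≤ y is x ∧ y ≈ x.
  IsPseudocomplement : (_∧_ : Op₂ A) (0# : A) (_* : Op₁ A) → Set (a ⊔ ℓ)
  IsPseudocomplement _∧_ 0# _* =
    ∀ x → ((x ∧ (x *)) ≈ 0#) × (∀ z → (x ∧ z) ≈ 0# → (z ∧ (x *)) ≈ z)

  IsDualPseudocomplement : (_∨_ _∧_ : Op₂ A) (1# : A) (_⁺ : Op₁ A) →
                           Set (a ⊔ ℓ)
  IsDualPseudocomplement _∨_ _∧_ 1# _⁺ =
    ∀ x → ((x ∨ (x ⁺)) ≈ 1#) × (∀ z → (x ∨ z) ≈ 1# → ((x ⁺) ∧ z) ≈ (x ⁺))

  Regular : (_∨_ _∧_ : Op₂ A) (_* _′ : Op₁ A) → Set (a ⊔ ℓ)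
  Regular _∨_ _∧_ _* _′ =
    ∀ x y → ((x ∧ (((x ′) *) ′)) ∨ (y ∨ (y *))) ≈ (y ∨ (y *))

  record IsRegularDeMorganPAlgebra
           (_∨_ _∧_ : Op₂ A) (_* _′ : Op₁ A) (0# 1# : A)
           : Set (a ⊔ ℓ) where
    field
      isDeMorganAlgebra  : IsDeMorganAlgebra _∨_ _∧_ _′ 0# 1#
      isPseudocomplement : IsPseudocomplement _∧_ 0# _*
      regular            : Regular _∨_ _∧_ _* _′

  record IsRegularDeMorganDoublePAlgebra
           (_∨_ _∧_ : Op₂ A) (_* _⁺ _′ : Op₁ A) (0# 1# : A)
           : Set (a ⊔ ℓ) where
    field
      isDeMorganAlgebra      : IsDeMorganAlgebra _∨_ _∧_ _′ 0# 1#
      isPseudocomplement     : IsPseudocomplement _∧_ 0# _*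
      isDualPseudocomplement : IsDualPseudocomplement _∨_ _∧_ 1# _⁺
      regular                : Regular _∨_ _∧_ _* _′

data DMOp : Signature where
  join meet : DMOp 2
  neg       : DMOp 1
  bot top   : DMOp 0

data DMPOp : Signature where
  dm   : ∀ {n} → DMOp n → DMPOp n
  star : DMPOp 1

data DMDBLPOp : Signature where
  dm        : ∀ {n} → DMOp n → DMDBLPOp n
  star plus : DMDBLPOp 1

module _ {S : Signature} {c ℓ} (A : Algebra S c ℓ) where

  open Algebra A using (Carrier; op)

  op₀ : S 0 → Carrier
  op₀ f = op f []

  op₁ : S 1 → Op₁ Carrier
  op₁ f x = op f (x ∷ [])

  op₂ : S 2 → Op₂ Carrier
  op₂ f x y = op f (x ∷ y ∷ [])

RDMP : ∀ c ℓ → Class DMPOp c ℓ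
RDMP c ℓ A = IsRegularDeMorganPAlgebra (Algebra._≈_ A)
  (op₂ A (dm join)) (op₂ A (dm meet))
  (op₁ A star) (op₁ A (dm neg))
  (op₀ A (dm bot)) (op₀ A (dm top))

RDMDBLP : ∀ c ℓ → Class DMDBLPOp c ℓ
RDMDBLP c ℓ A = IsRegularDeMorganDoublePAlgebra (Algebra._≈_ A)
  (op₂ A (dm join)) (op₂ A (dm meet))
  (op₁ A star) (op₁ A plus) (op₁ A (dm neg))
  (op₀ A (dm bot)) (op₀ A (dm top))

{-# OPTIONS --safe #-}
-- In a De Morgan p-algebra x′*′ is the dual pseudocomplement of x, because ′ is
-- a dual automorphism; dual pseudocomplements being unique, x⁺ ≈ x′*′ holds in
-- every De Morgan double p-algebra.
module Submission where

open import Algebra.Core using (Op₁; Op₂)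
open import Algebra.Lattice.Structures using (module IsDistributiveLattice)
open import Data.Fin.Base using (zero)
open import Data.Product.Base using (Σ-syntax; _,_; proj₁; proj₂)
open import Data.Vec.Functional using (Vector; []; _∷_)
open import Level using (Level)
open import Relation.Binary.Core using (Rel)
open import Relation.Binary.PropositionalEquality.Core using (refl)
open import Relation.Binary.Bundles using (Setoid)
import Relation.Binary.Reasoning.Setoid as SetoidReasoning
open import Defs

-- The operation ′ reverses the order and exchanges 0 with 1, so it carries the largest z with x′ ∧
-- z = 0 to the least z with x ∨ z = 1. Hence * already determines ⁺ as x′*′. One direction defines
-- `plus` by this term, the other discards `plus`. Regularity mentions only operations that both
-- translations fix, so it transfers as it stands. The one round trip with content restores `plus`,
-- by uniqueness of dual pseudocomplements.

module _ {a ℓ} {A : Set a} {_≈_ : Rel A ℓ} {_∨_ _∧_ : Op₂ A} {_′ : Op₁ A} {0# 1# : A}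
         (isDeMorganAlgebra : IsDeMorganAlgebra _≈_ _∨_ _∧_ _′ 0# 1#) where

  open IsDeMorganAlgebra isDeMorganAlgebra
  open IsDistributiveLattice isDistributiveLattice

  private
    setoid : Setoid a ℓ
    setoid = record { isEquivalence = isEquivalence }

  open SetoidReasoning setoid

  -- `_⁺` is any operation pointwise equal to x′*′, since the evaluated term agrees with x′*′ only
  -- up to `_≈_`.
  ′*′-isDualPseudocomplement :
    ∀ {_* _⁺ : Op₁ A} →
    IsPseudocomplement _≈_ _∧_ 0# _* →
    (∀ x → (x ⁺) ≈ (((x ′) *) ′)) →
    IsDualPseudocomplement _≈_ _∨_ _∧_ 1# _⁺
  ′*′-isDualPseudocomplement {_*} {_⁺} pseudo ⁺≈′*′ x = joins-to-1 , least
    where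
    joins-to-1 : (x ∨ (x ⁺)) ≈ 1#
    joins-to-1 = begin
      x ∨ (x ⁺)                    ≈⟨ ∨-cong (sym (′-involutive x)) (⁺≈′*′ x) ⟩
      ((x ′) ′) ∨ (((x ′) *) ′)    ≈⟨ ′-∧ (x ′) ((x ′) *) ⟨
      ((x ′) ∧ ((x ′) *)) ′        ≈⟨ ′-cong (proj₁ (pseudo (x ′))) ⟩
      0# ′                         ≈⟨ ′-0 ⟩
      1#                           ∎

    least : ∀ z → (x ∨ z) ≈ 1# → ((x ⁺) ∧ z) ≈ (x ⁺)
    least z x∨z≈1 = begin
      (x ⁺) ∧ z              ≈⟨ ∧-congˡ z≈z∨x⁺ ⟩
      (x ⁺) ∧ (z ∨ (x ⁺))    ≈⟨ ∧-congˡ (∨-comm z (x ⁺)) ⟩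
      (x ⁺) ∧ ((x ⁺) ∨ z)    ≈⟨ ∧-absorbs-∨ (x ⁺) z ⟩
      x ⁺                    ∎
      where
      x′∧z′≈0 : ((x ′) ∧ (z ′)) ≈ 0#
      x′∧z′≈0 = begin
        (x ′) ∧ (z ′)  ≈⟨ ′-∨ x z ⟨
        (x ∨ z) ′      ≈⟨ ′-cong x∨z≈1 ⟩
        1# ′           ≈⟨ ′-1 ⟩
        0#             ∎

      z≈z∨x⁺ : z ≈ (z ∨ (x ⁺))
      z≈z∨x⁺ = begin
        z                            ≈⟨ ′-involutive z ⟨
        -- From x′ ∧ z′ = 0 follows z′ ≤ x′*; applying ′ reverses this to x⁺ ≤ z, in its join form.
        (z ′) ′                      ≈⟨ ′-cong (proj₂ (pseudo (x ′)) (z ′) x′∧z′≈0) ⟨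
        ((z ′) ∧ ((x ′) *)) ′        ≈⟨ ′-∧ (z ′) ((x ′) *) ⟩
        ((z ′) ′) ∨ (((x ′) *) ′)    ≈⟨ ∨-cong (′-involutive z) (sym (⁺≈′*′ x)) ⟩
        z ∨ (x ⁺)                    ∎

  -- Each of the two values is least among the z with x ∨ z = 1, so each lies below the other.
  dualPseudocomplement-unique :
    ∀ {_⁺ _⁺′ : Op₁ A} →
    IsDualPseudocomplement _≈_ _∨_ _∧_ 1# _⁺ →
    IsDualPseudocomplement _≈_ _∨_ _∧_ 1# _⁺′ →
    ∀ x → (x ⁺) ≈ (x ⁺′)
  dualPseudocomplement-unique {_⁺} {_⁺′} dual dual′ x = begin
    x ⁺             ≈⟨ proj₂ (dual x) (x ⁺′) (proj₁ (dual′ x)) ⟨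
    (x ⁺) ∧ (x ⁺′)  ≈⟨ ∧-comm (x ⁺) (x ⁺′) ⟩
    (x ⁺′) ∧ (x ⁺)  ≈⟨ proj₂ (dual′ x) (x ⁺) (proj₁ (dual x)) ⟩
    x ⁺′            ∎

plus↦′*′ : Assignment DMDBLPOp DMPOp
plus↦′*′ (dm r) = basic (dm r)
plus↦′*′ star   = basic star
plus↦′*′ plus   = app (dm neg) λ _ → app star λ _ → basic (dm neg)

forgetPlus : Assignment DMPOp DMDBLPOp
forgetPlus (dm r) = basic (dm r)
forgetPlus star   = basic star

module _ {c ℓ : Level} where

  -- Symbols assigned to themselves evaluate to the original operations definitionally, so only the
  -- field for `plus` needs an argument.
  plus↦′*′-class : ∀ A → RDMP c ℓ A → RDMDBLP c ℓ (derived plus↦′*′ A)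
  plus↦′*′-class A isRDMP = record
    { isDeMorganAlgebra      = isDeMorganAlgebra
    ; isPseudocomplement     = isPseudocomplement
    ; isDualPseudocomplement =
        ′*′-isDualPseudocomplement isDeMorganAlgebra isPseudocomplement
          -- Vectors are functions, so these one-entry vectors agree only pointwise.
          λ _ → op-cong (dm neg) λ { zero →
                  op-cong star λ { zero → Algebra.refl A } }
    ; regular                = regular
    }
    where
    open IsRegularDeMorganPAlgebra isRDMP
    open Algebra A using (op-cong)

  forgetPlus-class : ∀ B → RDMDBLP c ℓ B → RDMP c ℓ (derived forgetPlus B)
  forgetPlus-class B isRDMDBLP = record
    { isDeMorganAlgebra  = isDeMorganAlgebra
    ; isPseudocomplement = isPseudocomplement
    ; regular            = regular
    }
    where open IsRegularDeMorganDoublePAlgebra isRDMDBLP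

  plus↦′*′-forgetPlus :
    ∀ B → RDMDBLP c ℓ B → let open Algebra B in
    ∀ {n} (g : DMDBLPOp n) (xs : Vector Carrier n) →
    Algebra.op (derived plus↦′*′ (derived forgetPlus B)) g xs ≈ op g xs
  plus↦′*′-forgetPlus B _         (dm r) _  = Algebra.refl B
  plus↦′*′-forgetPlus B _         star   _  = Algebra.refl B
  plus↦′*′-forgetPlus B isRDMDBLP plus   xs = begin
    -- Uniqueness speaks of unary operations, hence the passage to the vector `xs zero ∷ []` and
    -- back.
    D.op plus xs               ≈⟨ D.op-cong plus (λ { zero → B.refl }) ⟩
    D.op plus (xs zero ∷ [])   ≈⟨ dualPseudocomplement-unique
                                    isDeMorganAlgebra
                                    (IsRegularDeMorganDoublePAlgebra.isDualPseudocomplement D-isRDMDBLP)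
                                    isDualPseudocomplement (xs zero) ⟩
    B.op plus (xs zero ∷ [])   ≈⟨ B.op-cong plus (λ { zero → B.refl }) ⟩
    B.op plus xs               ∎
    where
    open IsRegularDeMorganDoublePAlgebra isRDMDBLP
    module B = Algebra B
    module D = Algebra (derived plus↦′*′ (derived forgetPlus B))
    open SetoidReasoning B.setoid
    -- `D` has the De Morgan operations of `B`, so its `plus` is a second dual pseudocomplement on
    -- the same lattice.
    D-isRDMDBLP = plus↦′*′-class (derived forgetPlus B) (forgetPlus-class B isRDMDBLP)

corollary2p10 : (c ℓ : Level) → Σ[ E ∈ TermEquivalence (RDMP c ℓ) (RDMDBLP c ℓ) ] KeepsUnchanged {R = DMOp} DMPOp.dm DMDBLPOp.dm E
corollary2p10 c ℓ = record
  { to         = plus↦′*′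
  ; from       = forgetPlus
  ; to-class   = plus↦′*′-class
  ; from-class = forgetPlus-class
  ; from-to    = λ { A _ (dm r) _ → Algebra.refl A ; A _ star _ → Algebra.refl A }
  ; to-from    = plus↦′*′-forgetPlus
  } , λ _ → refl , refl
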